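{- There exists a game $m$ over a set $N$ of players with $|N|=6$ such that both $m$ and its anti-dual $m^{\diamond}$ are totally balanced, while $m$ is not exact.
   Context: A game over a finite set $N$ is a function $m:\mathcal{P}(N)\to\mathbb{R}$ with $m(\emptyset)=0$, where $\mathcal{P}(N)$ is the power set of $N$. The core of $m$ is $C(m)=\{x\in\mathbb{R}^N:\sum_{i\in N}x_i=m(N),\ \sum_{i\in S}x_i\geq m(S)\ \forall S\subseteq N\}$. The game $m$ is balanced if $C(m)\neq\emptyset$. It is totally balanced if for every $\emptyset\neq S\subseteq N$ the subgame $m_S$ (the restriction of $m$ to $\mathcal{P}(S)$, viewed as a game over $S$) is balanced. It is exact if for each $S\subseteq N$ there exists $x\in C(m)$ with $\sum_{i\in S}x_i=m(S)$. The anti-dual of $m$ is the game $m^{\diamond}(S):=m(N\setminus S)-m(N)$ for $S\subseteq N$. -}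

module Defs where

open import Algebra.Bundles using (RawMonoid)
open import Data.Bool.Base using (if_then_else_)
open import Data.Fin.Subset using (Subset; inside; outside; ⊥; ⊤; ∁; ∣_∣; Nonempty)
open import Data.Fin.Subset.Properties using (_∈?_)
open import Data.Nat as ℕ using (ℕ; zero; suc)
import Data.Nat.Properties as ℕ
open import Data.Product using (Σ; ∃; ∃-syntax; _×_; _,_)
open import Data.Rational as ℚ using (ℚ; 0ℚ; ½)
import Data.Rational.Properties as ℚ
open import Data.Rational.Solver using (module +-*-Solver)
open import Data.Vec.Base using ([]; _∷_)
open import Data.Vec.Functional using (Vector)
open import Data.Vec.Properties using (map-replicate)
open import Level using (0ℓ)
open import Relation.Binary.PropositionalEquality
open import Relation.Nullary.Decidable using (does)
import Algebra.Definitions.RawMonoid as RawMonoidDefs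

private
  variable
    n : ℕ

-- The real numbers are constructed as Cauchy sequences of rationals, considered
-- up to the equality _≃_.

IsCauchy : (ℕ → ℚ) → Set
IsCauchy s = ∀ ε → 0ℚ ℚ.< ε →
  ∃[ K ] (∀ i j → K ℕ.≤ i → K ℕ.≤ j → ℚ.∣ s i ℚ.- s j ∣ ℚ.< ε)

record ℝ : Set where
  constructor mkℝ
  field
    seq    : ℕ → ℚ
    cauchy : IsCauchy seq

open ℝ public

infix 4 _≃_ _≤_ _≥_

_≃_ : ℝ → ℝ → Set
x ≃ y = ∀ ε → 0ℚ ℚ.< ε →
  ∃[ K ] (∀ i → K ℕ.≤ i → ℚ.∣ seq x i ℚ.- seq y i ∣ ℚ.< ε)

_≤_ : ℝ → ℝ → Set
x ≤ y = ∀ ε → 0ℚ ℚ.< ε →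
  ∃[ K ] (∀ i → K ℕ.≤ i → seq x i ℚ.≤ seq y i ℚ.+ ε)

_≥_ : ℝ → ℝ → Set
x ≥ y = y ≤ x

fromℚ : ℚ → ℝ
fromℚ q = mkℝ (λ _ → q) λ ε 0<ε →
  0 , λ _ _ _ _ → subst (λ d → ℚ.∣ d ∣ ℚ.< ε) (sym (ℚ.+-inverseʳ q)) 0<ε

0ℝ : ℝ
0ℝ = fromℚ 0ℚ

private
  0<½* : ∀ ε → 0ℚ ℚ.< ε → 0ℚ ℚ.< ½ ℚ.* ε
  0<½* ε 0<ε = subst (ℚ._< ½ ℚ.* ε) (ℚ.*-zeroʳ ½) (ℚ.*-monoʳ-<-pos ½ 0<ε)

  ½*+½* : ∀ ε → ½ ℚ.* ε ℚ.+ ½ ℚ.* ε ≡ ε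
  ½*+½* ε = trans (sym (ℚ.*-distribʳ-+ ε ½ ½)) (ℚ.*-identityˡ ε)

  +-swap : ∀ a b c d → (a ℚ.+ b) ℚ.- (c ℚ.+ d) ≡ (a ℚ.- c) ℚ.+ (b ℚ.- d)
  +-swap = solve 4 (λ a b c d → (a :+ b) :- (c :+ d) := (a :- c) :+ (b :- d)) refl
    where open +-*-Solver

  neg-diff : ∀ a b → (ℚ.- a) ℚ.- (ℚ.- b) ≡ ℚ.- (a ℚ.- b)
  neg-diff = solve 2 (λ a b → (:- a) :- (:- b) := :- (a :- b)) refl
    where open +-*-Solver

  +-cauchy : ∀ {s t} → IsCauchy s → IsCauchy t → IsCauchy (λ i → s i ℚ.+ t i)
  +-cauchy {s} {t} cs ct ε 0<ε with cs (½ ℚ.* ε) (0<½* ε 0<ε) | ct (½ ℚ.* ε) (0<½* ε 0<ε)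
  ... | K , p | L , q = K ℕ.⊔ L , λ i j le₁ le₂ → begin-strict
    ℚ.∣ (s i ℚ.+ t i) ℚ.- (s j ℚ.+ t j) ∣
      ≡⟨ cong ℚ.∣_∣ (+-swap (s i) (t i) (s j) (t j)) ⟩
    ℚ.∣ (s i ℚ.- s j) ℚ.+ (t i ℚ.- t j) ∣
      ≤⟨ ℚ.∣p+q∣≤∣p∣+∣q∣ (s i ℚ.- s j) (t i ℚ.- t j) ⟩
    ℚ.∣ s i ℚ.- s j ∣ ℚ.+ ℚ.∣ t i ℚ.- t j ∣
      <⟨ ℚ.+-mono-< (p i j (ℕ.m⊔n≤o⇒m≤o K L le₁) (ℕ.m⊔n≤o⇒m≤o K L le₂))
                    (q i j (ℕ.m⊔n≤o⇒n≤o K L le₁) (ℕ.m⊔n≤o⇒n≤o K L le₂)) ⟩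
    ½ ℚ.* ε ℚ.+ ½ ℚ.* ε
      ≡⟨ ½*+½* ε ⟩
    ε ∎
    where open ℚ.≤-Reasoning

  neg-cauchy : ∀ {s} → IsCauchy s → IsCauchy (λ i → ℚ.- s i)
  neg-cauchy {s} cs ε 0<ε with cs ε 0<ε
  ... | K , p = K , λ i j le₁ le₂ →
    subst (ℚ._< ε)
      (sym (trans (cong ℚ.∣_∣ (neg-diff (s i) (s j))) (ℚ.∣-p∣≡∣p∣ (s i ℚ.- s j))))
      (p i j le₁ le₂)

infixl 6 _+_ _-_
infix  8 -_

_+_ : ℝ → ℝ → ℝ
x + y = mkℝ (λ i → seq x i ℚ.+ seq y i)
            (+-cauchy {seq x} {seq y} (cauchy x) (cauchy y))

-_ : ℝ → ℝ
- x = mkℝ (λ i → ℚ.- seq x i) (neg-cauchy {seq x} (cauchy x))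

_-_ : ℝ → ℝ → ℝ
x - y = x + (- y)

x-x≃0 : ∀ x → x - x ≃ 0ℝ
x-x≃0 x ε 0<ε = 0 , λ i _ →
  subst (λ d → ℚ.∣ d ℚ.- 0ℚ ∣ ℚ.< ε) (sym (ℚ.+-inverseʳ (seq x i))) 0<ε

+-rawMonoid : RawMonoid 0ℓ 0ℓ
+-rawMonoid = record { Carrier = ℝ ; _≈_ = _≃_ ; _∙_ = _+_ ; ε = 0ℝ }

open RawMonoidDefs +-rawMonoid public using (sum)

-- A game over an n-element set of players, the set being taken to be Fin n.

record Game (n : ℕ) : Set where
  field
    worth   : Subset n → ℝ
    worth-⊥ : worth ⊥ ≃ 0ℝ

open Game public

-- ∑[ S ] x is the sum of x i over the players i in S.

∑[_]_ : Subset n → Vector ℝ n → ℝ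
∑[ S ] x = sum (λ i → if does (i ∈? S) then x i else 0ℝ)

InCore : Game n → Vector ℝ n → Set
InCore m x = (∑[ ⊤ ] x ≃ worth m ⊤) × (∀ S → ∑[ S ] x ≥ worth m S)

Core : Game n → Set
Core {n} m = Σ (Vector ℝ n) (InCore m)

Balanced : Game n → Set
Balanced m = Core m

-- The members of a coalition S, listed in increasing order, are identified with
-- Fin ∣ S ∣. Under this identification embed S is the bijection from the subsets
-- of Fin ∣ S ∣ to the subsets of Fin n contained in S.

embed : (S : Subset n) → Subset ∣ S ∣ → Subset n
embed []            []      = []
embed (inside  ∷ S) (t ∷ T) = t ∷ embed S T
embed (outside ∷ S) T       = outside ∷ embed S T

embed-⊥ : (S : Subset n) → embed S ⊥ ≡ ⊥
embed-⊥ []            = refl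
embed-⊥ (inside  ∷ S) = cong (outside ∷_) (embed-⊥ S)
embed-⊥ (outside ∷ S) = cong (outside ∷_) (embed-⊥ S)

subgame : Game n → (S : Subset n) → Game ∣ S ∣
subgame m S = record
  { worth   = λ T → worth m (embed S T)
  ; worth-⊥ = subst (λ T → worth m T ≃ 0ℝ) (sym (embed-⊥ S)) (worth-⊥ m)
  }

TotallyBalanced : Game n → Set
TotallyBalanced m = ∀ S → Nonempty S → Balanced (subgame m S)

Exact : Game n → Set
Exact m = ∀ S → ∃[ x ] (InCore m x × ∑[ S ] x ≃ worth m S)

antiDual : Game n → Game n
antiDual {n} m = record
  { worth   = λ S → worth m (∁ S) - worth m ⊤
  ; worth-⊥ = subst (λ T → worth m T - worth m ⊤ ≃ 0ℝ)
                    (sym (map-replicate _ outside n)) (x-x≃0 (worth m ⊤))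
  }

{-# OPTIONS --safe #-}

-- A minimum of additive games is totally balanced, since an additive game
-- attaining the minimum at S restricts to a core element of the subgame on S.
-- Group the six players into three pairs, one member of each pair being in A₀ and
-- the other in ∁ A₀, and let charge S be worth 2 on S and -1 off S. The game m is
-- the minimum of charge (∁ A₀) and of ±charge P over the pairs P. Its anti-dual is
-- the minimum of charge A₀ and of ±charge P, so both games are totally balanced.
-- For each pair P let T be A₀ with its member in P replaced by the partner. Then
-- m(T) = 0, and the indicators of the three T's sum to that of all players plus
-- that of A₀. A core element x thus has x(A₀) ≥ -m(⊤) = 0, although m(A₀) = -3.

module Submission where

open import Defs
open import Data.Bool.Base using (if_then_else_)
open import Data.Fin using (#_)
open import Data.Fin.Subset using (Subset; inside; outside; ⊥; ⊤; ∁; ∣_∣; ⁅_⁆; _∪_)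
open import Data.Fin.Subset.Properties using (anySubset?)
open import Data.List.Base using (List; []; _∷_; _++_; map)
import Data.List.Extrema as Extrema
open import Data.Nat as ℕ using (ℕ)
import Data.Nat.Properties as ℕ
open import Data.Product using (Σ-syntax; ∃-syntax; _×_; _,_)
open import Data.Rational as ℚ using (ℚ; 0ℚ; 1ℚ; ½)
import Data.Rational.Properties as ℚ
open import Data.Rational.Solver using (module +-*-Solver)
open import Data.Vec.Base using ([]; _∷_; lookup)
open import Data.Vec.Functional as Vector using (Vector; head; tail)
open import Data.Sum.Base using (inj₁; inj₂)
open import Level using (Level)
open import Relation.Binary.Bundles using (DecTotalOrder)
open import Relation.Binary.PropositionalEquality
open import Relation.Nullary using (¬_)
open import Relation.Nullary.Decidable using (¬?; decidable-stable; from-no; from-yes)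

open Extrema (DecTotalOrder.totalOrder ℚ.≤-decTotalOrder)
  using (argmin; argmin-all; f[argmin]≤f[⊤]; f[argmin]≤f[xs])

private
  variable
    a : Level
    A : Set a
    n : ℕ

≗⇒≃ : ∀ {x y} → seq x ≗ seq y → x ≃ y
≗⇒≃ {x} {y} x≗y ε 0<ε = 0 , λ i _ → subst (λ d → ℚ.∣ d ∣ ℚ.< ε)
  (sym (trans (cong (ℚ._- seq y i) (x≗y i)) (ℚ.+-inverseʳ (seq y i)))) 0<ε

p≤p+ε : ∀ p {ε} → 0ℚ ℚ.< ε → p ℚ.≤ p ℚ.+ ε
p≤p+ε p {ε} 0<ε = subst (ℚ._≤ p ℚ.+ ε) (ℚ.+-identityʳ p) (ℚ.+-monoʳ-≤ p (ℚ.<⇒≤ 0<ε))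

pointwise-≤ : ∀ {x y} → (∀ i → seq x i ℚ.≤ seq y i) → x ≤ y
pointwise-≤ {y = y} x≤y ε 0<ε = 0 , λ i _ → ℚ.≤-trans (x≤y i) (p≤p+ε (seq y i) 0<ε)

-- For constant sequences the index `K` supplied by `x ≤ y` already carries all the information. The
-- slack `ε` stays in the conclusion because a strict gap between `p` and `q` is refuted by any `ε`
-- below the gap.
constant-≤ : ∀ {x y p q} → (∀ i → seq x i ≡ p) → (∀ i → seq y i ≡ q) → x ≤ y →
             ∀ ε → 0ℚ ℚ.< ε → p ℚ.≤ q ℚ.+ ε
constant-≤ x≡p y≡q x≤y ε 0<ε with x≤y ε 0<ε
... | K , x≤y+ε = subst₂ (λ p q → p ℚ.≤ q ℚ.+ ε) (x≡p K) (y≡q K) (x≤y+ε K ℕ.≤-refl)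

p≤∣p∣ : ∀ p → p ℚ.≤ ℚ.∣ p ∣
p≤∣p∣ p with ℚ.≤-total 0ℚ p
... | inj₁ 0≤p = ℚ.≤-reflexive (sym (ℚ.0≤p⇒∣p∣≡p 0≤p))
... | inj₂ p≤0 = ℚ.≤-trans p≤0 (ℚ.0≤∣p∣ p)

≃⇒≤ : ∀ {x y} → x ≃ y → x ≤ y
≃⇒≤ {x} {y} x≃y ε 0<ε with x≃y ε 0<ε
... | K , p = K , λ i K≤i → begin
  seq x i                             ≡⟨ split (seq x i) (seq y i) ⟩
  seq y i ℚ.+ (seq x i ℚ.- seq y i)   ≤⟨ ℚ.+-monoʳ-≤ (seq y i)
                                           (ℚ.≤-trans (p≤∣p∣ _) (ℚ.<⇒≤ (p i K≤i))) ⟩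
  seq y i ℚ.+ ε                       ∎
  where
  open ℚ.≤-Reasoning
  split : ∀ p q → p ≡ q ℚ.+ (p ℚ.- q)
  split = solve 2 (λ p q → p := q :+ (p :- q)) refl
    where open +-*-Solver

halve : ∀ ε → 0ℚ ℚ.< ε → ∃[ δ ] (0ℚ ℚ.< δ × δ ℚ.+ δ ≡ ε)
halve ε 0<ε = ½ ℚ.* ε ,
  subst (ℚ._< ½ ℚ.* ε) (ℚ.*-zeroʳ ½) (ℚ.*-monoʳ-<-pos ½ 0<ε) ,
  trans (sym (ℚ.*-distribʳ-+ ε ½ ½)) (ℚ.*-identityˡ ε)

≤-trans : ∀ {x y z} → x ≤ y → y ≤ z → x ≤ z
≤-trans {x} {y} {z} x≤y y≤z ε 0<ε with halve ε 0<ε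
... | δ , 0<δ , refl with x≤y δ 0<δ | y≤z δ 0<δ
... | K , p | L , q = K ℕ.⊔ L , λ i le → begin
  seq x i                      ≤⟨ p i (ℕ.m⊔n≤o⇒m≤o K L le) ⟩
  seq y i ℚ.+ δ                ≤⟨ ℚ.+-monoˡ-≤ δ (q i (ℕ.m⊔n≤o⇒n≤o K L le)) ⟩
  seq z i ℚ.+ δ ℚ.+ δ          ≡⟨ ℚ.+-assoc (seq z i) δ δ ⟩
  seq z i ℚ.+ (δ ℚ.+ δ)        ∎
  where open ℚ.≤-Reasoning

+-mono-≤ : ∀ {x y z w} → x ≤ y → z ≤ w → x + z ≤ y + w
+-mono-≤ {x} {y} {z} {w} x≤y z≤w ε 0<ε with halve ε 0<ε
... | δ , 0<δ , refl with x≤y δ 0<δ | z≤w δ 0<δ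
... | K , p | L , q = K ℕ.⊔ L , λ i le → begin
  seq x i ℚ.+ seq z i
    ≤⟨ ℚ.+-mono-≤ (p i (ℕ.m⊔n≤o⇒m≤o K L le)) (q i (ℕ.m⊔n≤o⇒n≤o K L le)) ⟩
  (seq y i ℚ.+ δ) ℚ.+ (seq w i ℚ.+ δ)
    ≡⟨ interchange (seq y i) (seq w i) δ ⟩
  (seq y i ℚ.+ seq w i) ℚ.+ (δ ℚ.+ δ) ∎
  where
  open ℚ.≤-Reasoning
  interchange : ∀ p q r → (p ℚ.+ r) ℚ.+ (q ℚ.+ r) ≡ (p ℚ.+ q) ℚ.+ (r ℚ.+ r)
  interchange = solve 3 (λ p q r → (p :+ r) :+ (q :+ r) := (p :+ q) :+ (r :+ r)) refl
    where open +-*-Solver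

-- The rational counterpart of `∑[_]_`: the value at `S` of the additive game given by `x`. Players
-- outside `S` contribute no zero summand, so restriction to a coalition and ring identities follow
-- the recursion directly.
weight : Subset n → Vector ℚ n → ℚ
weight []            x = 0ℚ
weight (inside  ∷ S) x = head x ℚ.+ weight S (tail x)
weight (outside ∷ S) x = weight S (tail x)

seq-∑ : ∀ (S : Subset n) x k → seq (∑[ S ] x) k ≡ weight S (λ i → seq (x i) k)
seq-∑ []            x k = refl
seq-∑ (inside  ∷ S) x k = cong (seq (head x) k ℚ.+_) (seq-∑ S (tail x) k)
seq-∑ (outside ∷ S) x k = trans (ℚ.+-identityˡ _) (seq-∑ S (tail x) k)

restrict : (S : Subset n) → Vector A n → Vector A ∣ S ∣
restrict []            x = x
restrict (inside  ∷ S) x = head x Vector.∷ restrict S (tail x)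
restrict (outside ∷ S) x = restrict S (tail x)

weight-restrict : ∀ (S : Subset n) T x → weight T (restrict S x) ≡ weight (embed S T) x
weight-restrict []            []            x = refl
weight-restrict (inside  ∷ S) (inside  ∷ T) x = cong (head x ℚ.+_) (weight-restrict S T (tail x))
weight-restrict (inside  ∷ S) (outside ∷ T) x = weight-restrict S T (tail x)
weight-restrict (outside ∷ S) T             x = weight-restrict S T (tail x)

embed-⊤ : (S : Subset n) → embed S ⊤ ≡ S
embed-⊤ []            = refl
embed-⊤ (inside  ∷ S) = cong (inside ∷_) (embed-⊤ S)
embed-⊤ (outside ∷ S) = cong (outside ∷_) (embed-⊤ S)

-- Expressed through `argmin` so that an additive game attaining the minimum is at hand as a core
-- element; `u` keeps the family nonempty.
minimum : Vector ℚ n → List (Vector ℚ n) → Subset n → ℚ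
minimum u X S = weight S (argmin (weight S) u X)

-- The minimizer at `S` is a member of the family `u ∷ X`, and every member bounds the minimum at
-- `T` from above.
minimum≤weight-argmin : ∀ (u : Vector ℚ n) X S T →
                        minimum u X T ℚ.≤ weight T (argmin (weight S) u X)
minimum≤weight-argmin u X S T =
  argmin-all (weight S) {P = λ x → minimum u X T ℚ.≤ weight T x}
    (f[argmin]≤f[⊤] {f = weight T} u X) (f[argmin]≤f[xs] {f = weight T} u X)

minimum⇒totallyBalanced : ∀ (m : Game n) u X →
                          (∀ S k → seq (worth m S) k ≡ minimum u X S) → TotallyBalanced m
minimum⇒totallyBalanced m u X m≡min S _ = core ,
  ≗⇒≃ {∑[ ⊤ ] core} {worth m (embed S ⊤)} (λ k → begin
    seq (∑[ ⊤ ] core) k              ≡⟨ seq-∑-core ⊤ k ⟩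
    weight (embed S ⊤) x             ≡⟨ cong (λ T → weight T x) (embed-⊤ S) ⟩
    minimum u X S                    ≡⟨ cong (minimum u X) (embed-⊤ S) ⟨
    minimum u X (embed S ⊤)          ≡⟨ m≡min (embed S ⊤) k ⟨
    seq (worth m (embed S ⊤)) k      ∎) ,
  λ T → pointwise-≤ {worth m (embed S T)} {∑[ T ] core} (λ k → subst₂ ℚ._≤_
    (sym (m≡min (embed S T) k)) (sym (seq-∑-core T k))
    (minimum≤weight-argmin u X S (embed S T)))
  where
  open ≡-Reasoning
  -- Chosen from `S` alone, so one vector satisfies the inequalities for all `T` and is tight at
  -- `S`.
  x = argmin (weight S) u X
  core = λ i → fromℚ (restrict S x i)
  seq-∑-core : ∀ T k → seq (∑[ T ] core) k ≡ weight (embed S T) x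
  seq-∑-core T k = trans (seq-∑ T core k) (weight-restrict S T x)

charge : Subset n → Vector ℚ n
charge S i = if lookup S i then 1ℚ ℚ.+ 1ℚ else ℚ.- 1ℚ

pairCharges : List (Vector ℚ 6)
pairCharges =
  charge (⁅ # 0 ⁆ ∪ ⁅ # 3 ⁆) ∷ charge (⁅ # 1 ⁆ ∪ ⁅ # 4 ⁆) ∷ charge (⁅ # 2 ⁆ ∪ ⁅ # 5 ⁆) ∷ []

-- A pair charge totals 2 + 2 - 4 = 0 over all players, so passing to the complement negates it.
-- Taking both signs makes the family invariant under complementation.
±pairCharges : List (Vector ℚ 6)
±pairCharges = pairCharges ++ map (λ x i → ℚ.- x i) pairCharges

A₀ T₀ T₁ T₂ : Subset 6
A₀ = ⁅ # 0 ⁆ ∪ ⁅ # 1 ⁆ ∪ ⁅ # 2 ⁆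
T₀ = ⁅ # 3 ⁆ ∪ ⁅ # 1 ⁆ ∪ ⁅ # 2 ⁆
T₁ = ⁅ # 0 ⁆ ∪ ⁅ # 4 ⁆ ∪ ⁅ # 2 ⁆
T₂ = ⁅ # 0 ⁆ ∪ ⁅ # 1 ⁆ ∪ ⁅ # 5 ⁆

game : Game 6
game = record
  { worth   = λ S → fromℚ (minimum (charge (∁ A₀)) ±pairCharges S)
  ; worth-⊥ = ≗⇒≃ {fromℚ (minimum (charge (∁ A₀)) ±pairCharges ⊥)} {0ℝ} (λ _ → refl)
  }

-- If `S` has three members, `charge (∁ A₀)` at `∁ S` equals `charge A₀` at `S`. For every other
-- size some signed pair charge is at most both of these values. The search over all 64 coalitions
-- verifies this.
antiDual-minimum : ∀ S → minimum (charge (∁ A₀)) ±pairCharges (∁ S) ℚ.-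
                         minimum (charge (∁ A₀)) ±pairCharges ⊤ ≡
                         minimum (charge A₀) ±pairCharges S
antiDual-minimum S = decidable-stable (_ ℚ.≟ _) λ ≢ → no-counterexample (S , ≢)
  where
  no-counterexample = from-no (anySubset? λ S → ¬? (
    minimum (charge (∁ A₀)) ±pairCharges (∁ S) ℚ.- minimum (charge (∁ A₀)) ±pairCharges ⊤
      ℚ.≟ minimum (charge A₀) ±pairCharges S))

weight-T₀+T₁+T₂ : ∀ x → weight T₀ x ℚ.+ weight T₁ x ℚ.+ weight T₂ x ≡ weight ⊤ x ℚ.+ weight A₀ x
weight-T₀+T₁+T₂ x = identity (x (# 0)) (x (# 1)) (x (# 2)) (x (# 3)) (x (# 4)) (x (# 5))
  where
  open +-*-Solver
  -- Both sides are spelled out as `weight` unfolds, each sum ending in the `0ℚ` of the empty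
  -- vector.
  identity : ∀ a b c d e f →
    (b ℚ.+ (c ℚ.+ (d ℚ.+ 0ℚ))) ℚ.+ (a ℚ.+ (c ℚ.+ (e ℚ.+ 0ℚ))) ℚ.+ (a ℚ.+ (b ℚ.+ (f ℚ.+ 0ℚ))) ≡
    (a ℚ.+ (b ℚ.+ (c ℚ.+ (d ℚ.+ (e ℚ.+ (f ℚ.+ 0ℚ)))))) ℚ.+ (a ℚ.+ (b ℚ.+ (c ℚ.+ 0ℚ)))
  identity = solve 6 (λ a b c d e f →
    (b :+ (c :+ (d :+ con 0ℚ))) :+ (a :+ (c :+ (e :+ con 0ℚ))) :+ (a :+ (b :+ (f :+ con 0ℚ))) :=
    (a :+ (b :+ (c :+ (d :+ (e :+ (f :+ con 0ℚ)))))) :+ (a :+ (b :+ (c :+ con 0ℚ)))) refl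

-- Take a core element tight at `A₀`: it bounds the worths of the three `T`'s from above and matches
-- `m` at `⊤` and `A₀`, so `weight-T₀+T₁+T₂` links the two sides.
exact⇒T₀+T₁+T₂≤⊤+A₀ : ∀ (m : Game 6) → Exact m →
                        worth m T₀ + worth m T₁ + worth m T₂ ≤ worth m ⊤ + worth m A₀
exact⇒T₀+T₁+T₂≤⊤+A₀ m exact with exact A₀
... | x , (x⊤≃m⊤ , x≥m) , xA₀≃mA₀ =
  ≤-trans {mT} {xT} {worth m ⊤ + worth m A₀} mT≤xT
    (≤-trans {xT} {∑[ ⊤ ] x + ∑[ A₀ ] x} {worth m ⊤ + worth m A₀} xT≤x⊤+xA₀ x⊤+xA₀≤m⊤+mA₀)
  where
  mT = worth m T₀ + worth m T₁ + worth m T₂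
  xT = ∑[ T₀ ] x + ∑[ T₁ ] x + ∑[ T₂ ] x

  mT≤xT : mT ≤ xT
  mT≤xT = +-mono-≤ {worth m T₀ + worth m T₁} {∑[ T₀ ] x + ∑[ T₁ ] x} {worth m T₂} {∑[ T₂ ] x}
    (+-mono-≤ {worth m T₀} {∑[ T₀ ] x} {worth m T₁} {∑[ T₁ ] x} (x≥m T₀) (x≥m T₁)) (x≥m T₂)

  xT≤x⊤+xA₀ : xT ≤ ∑[ ⊤ ] x + ∑[ A₀ ] x
  xT≤x⊤+xA₀ = pointwise-≤ {xT} {∑[ ⊤ ] x + ∑[ A₀ ] x} λ k → ℚ.≤-reflexive (trans
    (cong₂ ℚ._+_ (cong₂ ℚ._+_ (seq-∑ T₀ x k) (seq-∑ T₁ x k)) (seq-∑ T₂ x k))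
    (trans (weight-T₀+T₁+T₂ (λ i → seq (x i) k))
           (sym (cong₂ ℚ._+_ (seq-∑ ⊤ x k) (seq-∑ A₀ x k)))))

  x⊤+xA₀≤m⊤+mA₀ : ∑[ ⊤ ] x + ∑[ A₀ ] x ≤ worth m ⊤ + worth m A₀
  x⊤+xA₀≤m⊤+mA₀ = +-mono-≤ {∑[ ⊤ ] x} {worth m ⊤} {∑[ A₀ ] x} {worth m A₀}
    (≃⇒≤ {∑[ ⊤ ] x} {worth m ⊤} x⊤≃m⊤) (≃⇒≤ {∑[ A₀ ] x} {worth m A₀} xA₀≃mA₀)

¬exact : ¬ Exact game
-- The two sides evaluate to 0 and to 0 - 3 = `q`; slack 1 is below this gap of 3.
¬exact exact = from-no (0ℚ ℚ.≤? q ℚ.+ 1ℚ) (constant-≤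
  {worth game T₀ + worth game T₁ + worth game T₂} {worth game ⊤ + worth game A₀} {0ℚ} {q}
  (λ _ → refl) (λ _ → refl) (exact⇒T₀+T₁+T₂≤⊤+A₀ game exact)
  1ℚ (from-yes (0ℚ ℚ.<? 1ℚ)))
  where
  q = ℚ.- (1ℚ ℚ.+ 1ℚ ℚ.+ 1ℚ)

mainTheorem2 : Σ[ m ∈ Game 6 ] (TotallyBalanced m × TotallyBalanced (antiDual m) × ¬ Exact m)
mainTheorem2 = game ,
  minimum⇒totallyBalanced game (charge (∁ A₀)) ±pairCharges (λ _ _ → refl) ,
  minimum⇒totallyBalanced (antiDual game) (charge A₀) ±pairCharges (λ S _ → antiDual-minimum S) ,
  ¬exact
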